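{- Let $n$, $k$ and $r$ be positive integers with $n \geq (k+1)r$, and let $\mathcal{A}$ be an intersecting subfamily of $[n]^{(r)}_k$, the family of $k$-separated $r$-element subsets of $[n]$. Then \[|\mathcal{A}| \leq \binom{n - kr - 1}{r - 1},\] and the upper bound is attained (equality holds) if, for some $x \in [n]$, $\mathcal{A} = \{A \in [n]^{(r)}_k \colon x \in A\}$.
   Context: $[n]$ denotes the set $\{1, \dots, n\}$. A family $\mathcal{A}$ of subsets of $[n]$ is intersecting if $A \cap B \neq \emptyset$ for every $A, B \in \mathcal{A}$. A subset $A = \{a_1, \dots, a_r\}$ of $[n]$ (with $r$ elements, listed in increasing order $a_1 < \dots < a_r$) is $k$-separated if $a_{i+1} > a_i + k$ for each $i \in [r]$, where $a_{r+1} = a_1 + n$. Equivalently, when the elements of $[n]$ are placed in order on a circle, between any two elements of $A$ there are at least $k$ elements of $[n]$ that are not in $A$. The family of all $k$-separated $r$-element subsets of $[n]$ is denoted by $[n]^{(r)}_k$. -}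

module Defs where

open import Data.Fin using (Fin; toℕ)
open import Data.Fin.Subset using (Subset; _∈_; _∩_; Nonempty; ∣_∣; inside; outside)
open import Data.Fin.Subset.Properties using (_∈?_)
open import Data.List using (List; []; _∷_; _++_; [_]; map; filter; length; allFin)
open import Data.List.Relation.Unary.Linked using (Linked)
open import Data.Nat using (ℕ; zero; suc; _+_; _<_)
open import Data.Product using (_×_)
open import Data.Vec using ([]; _∷_)
open import Level using (0ℓ)
open import Relation.Binary.PropositionalEquality using (_≡_)
open import Relation.Unary using (Pred; Decidable)

-- The ground set [n] = {1, …, n} is Fin n, with labels shifted to 0, …, n - 1;
-- separation only depends on differences of labels.

-- The elements a₁ < … < aᵣ of A, in increasing order.
elements : ∀ {n} → Subset n → List ℕ
elements {n} A = map toℕ (filter (_∈? A) (allFin n))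

-- Appends aᵣ₊₁ = a₁ + n to a₁, …, aᵣ.
close : ℕ → List ℕ → List ℕ
close n []       = []
close n (a ∷ as) = (a ∷ as) ++ [ a + n ]

-- aᵢ₊₁ > aᵢ + k for every i ∈ [r], including the wrap-around step i = r.
Separated : ∀ {n} → ℕ → Subset n → Set
Separated {n} k A = Linked (λ a b → a + k < b) (close n (elements A))

Family : ℕ → Set₁
Family n = Pred (Subset n) 0ℓ

-- [n]⁽ʳ⁾ₖ
SeparatedSets : (n k r : ℕ) → Family n
SeparatedSets n k r A = ∣ A ∣ ≡ r × Separated k A

Star : ∀ {n} (k r : ℕ) → Fin n → Family n
Star {n} k r x A = SeparatedSets n k r A × x ∈ A

-- A and B are not required to be distinct.
Intersecting : ∀ {n} → Family n → Set
Intersecting 𝒜 = ∀ {A B} → 𝒜 A → 𝒜 B → Nonempty (A ∩ B)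

-- Lists every subset exactly once.
allSubsets : ∀ n → List (Subset n)
allSubsets zero    = [] ∷ []
allSubsets (suc n) = map (inside ∷_) (allSubsets n) ++ map (outside ∷_) (allSubsets n)

card : ∀ {n} {𝒜 : Family n} → Decidable 𝒜 → ℕ
card {n} 𝒜? = length (filter 𝒜? (allSubsets n))

{-# OPTIONS --safe #-}
module Submission where

-- Identify the first two points of the circle [n]. An unmarked member of 𝒜
-- becomes a k-separated r-set of [n - 1]. A member is marked if this destroys
-- separation (a gap of exactly k crosses the identified pair), or if it contains
-- the first point and moving that point to the second gives another member of 𝒜.
-- Marked members have exactly one element among the first k + 1 points;
-- deleting these points leaves a k-separated (r - 1)-set of [n - k - 1].
-- Both operations are injective on their part of 𝒜 and produce intersecting
-- families, so induction and Pascal's rule give the bound. Conversely the same two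
-- operations can be undone on sets containing the first point, which produces
-- a star of the full size there; rotation moves it to any other centre.

open import Defs

-- Linear inequalities between positions on the circle.

module Arithmetic where
  open import Data.List using ([]; _∷_)
  open import Data.Nat
  open import Data.Nat.Properties
  open import Data.Nat.Tactic.RingSolver using (solve)
  open import Relation.Binary.PropositionalEquality using (_≡_)

  -- b − a = (d − c) + s, stated without subtraction so that the ring solver proves it.
  lin : ∀ {a b c d} s → c ≤ d → a + d + s ≡ c + b → a ≤ b
  lin {a} {b} {c} {d} s c≤d eq = +-cancelˡ-≤ d a b (begin
    d + a      ≡⟨ +-comm d a ⟩
    a + d      ≤⟨ m≤m+n (a + d) s ⟩
    a + d + s  ≡⟨ eq ⟩
    c + b      ≤⟨ +-monoˡ-≤ b c≤d ⟩
    d + b      ∎)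
    where open ≤-Reasoning

  -- In these inequalities the separation is 1 + k and the circle has 2 + k + m points.
  wrap-second : ∀ j k m → suc (suc (j + suc k)) < suc (suc (suc (k + m))) → suc j ≤ m
  wrap-second j k m p = lin 0 p (solve (j ∷ k ∷ m ∷ []))

  wrap-merged-second : ∀ j k m → suc j < m → suc j + suc k < suc (k + m)
  wrap-merged-second j k m p = lin 0 p (solve (j ∷ k ∷ m ∷ []))

  wrap-later : ∀ i j k m → suc (suc (j + suc k)) < suc (suc (i + suc (suc (k + m)))) → j ≤ i + m
  wrap-later i j k m p = lin 0 p (solve (i ∷ j ∷ k ∷ m ∷ []))

  wrap-merged-later : ∀ i j k m → j < i + m → suc j + suc k < suc i + suc (k + m)
  wrap-merged-later i j k m p = lin 0 p (solve (i ∷ j ∷ k ∷ m ∷ []))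

  wrap-dropped-first : ∀ i j k m → suc (suc (k + j + suc k)) < suc (suc (k + m)) → j + suc k < i + m
  wrap-dropped-first i j k m p = lin i p (solve (i ∷ j ∷ k ∷ m ∷ []))

  wrap-dropped : ∀ i j k m p → suc (suc (k + j)) ≤ suc p + m → suc p + suc k < suc (suc (k + i)) → j + suc k < i + m
  wrap-dropped i j k m p q r = lin 0 (+-mono-≤ q r) (solve (i ∷ j ∷ k ∷ m ∷ p ∷ []))

  before-partner : ∀ j k m p → suc (suc (k + j + suc k)) < suc p + suc (suc (k + m)) → suc (suc (k + j)) ≤ suc p + m
  before-partner j k m p q = lin 0 q (solve (j ∷ k ∷ m ∷ p ∷ []))

  partner-order : ∀ k m p q → suc q + m + suc k < p + suc (suc (k + m)) → suc q ≤ p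
  partner-order k m p q r = lin 0 r (solve (k ∷ m ∷ p ∷ q ∷ []))

  -- Each of the two arcs between `i` and `j` has at least 2 + k steps, and together they make up
  -- the 2 + k + m steps of the circle.
  two-gaps : ∀ i j k m → i + suc k < j → j + suc k < i + suc (suc (k + m)) → suc k < m
  two-gaps i j k m p q = lin 0 (+-mono-≤ p q) (solve (i ∷ j ∷ k ∷ m ∷ []))

open import Data.Bool using (_∨_)
open import Data.Bool.Properties as Bool using ()
open import Data.Empty using (⊥)
open import Data.Fin using (Fin; toℕ; zero; suc)
open import Data.Fin.Properties using (toℕ-injective; toℕ<n)
open import Data.Fin.Subset using (Subset; Side; inside; outside; ∣_∣; _∩_; Nonempty) renaming (_∈_ to _∈ˢ_)
open import Data.Fin.Subset.Properties using (x∈p∩q⁺; x∈p∩q⁻) renaming (_∈?_ to _∈ˢ?_)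
open import Data.List using (List; []; _∷_; _++_; [_]; map; filter; length; allFin)
open import Data.List.Membership.Propositional using (_∈_)
open import Data.List.Membership.Propositional.Properties
  using (∈-map⁺; ∈-map⁻; ∈-filter⁺; ∈-filter⁻; ∈-++⁺ˡ; ∈-++⁺ʳ; ∈-++⁻; ∈-allFin)
open import Data.List.Properties using (length-map; length-++)
open import Data.List.Relation.Unary.All as All using (All; []; _∷_)
open import Data.List.Relation.Unary.AllPairs as AllPairs using (AllPairs; []; _∷_)
import Data.List.Relation.Unary.AllPairs.Properties as AllPairs
open import Data.List.Relation.Unary.Any using (here; there)
open import Data.List.Relation.Unary.Linked using (Linked)
open import Data.List.Relation.Unary.Linked.Properties using (AllPairs⇒Linked; Linked⇒AllPairs)
open import Data.List.Relation.Unary.Unique.Propositional using (Unique)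
import Data.List.Relation.Unary.Unique.Propositional.Properties as Unique
open import Data.Nat
open import Data.Nat.Combinatorics using (_C_; nCk≡nC[n∸k]; nCn≡1; nCk+nC[k+1]≡[n+1]C[k+1])
open import Data.Nat.Combinatorics.Specification using (k>n⇒nCk≡0)
open import Data.Nat.Induction using (Acc; acc; <-wellFounded)
open import Data.Nat.Properties
open import Data.Product using (∃; ∃₂; _×_; _,_; proj₁; proj₂)
open import Data.Sum using (_⊎_; inj₁; inj₂)
open import Data.Vec as Vec using ([]; _∷_; _∷ʳ_; replicate; here; there)
open import Data.Vec.Properties using (∷ʳ-injective; ≡-dec; ++-injective)
open import Level using (0ℓ)
open import Function using (_∘_; id)
open import Relation.Binary using (tri<; tri≈; tri>)
open import Relation.Binary.PropositionalEquality hiding ([_])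
open import Relation.Nullary using (¬_; Dec; yes; no; ¬?; contradiction)
open import Relation.Nullary.Decidable using (_×-dec_; _⊎-dec_)
open import Relation.Unary using (Pred; Decidable; _⊆_; _≐_)

open Arithmetic

private variable
  n m : ℕ

-- Membership by natural-number position.

infix 4 _∋_ _∋?_

-- Positions are naturals so that shifted points such as `suc p + m` can be named without a proof
-- that they lie on the circle; a position past the end is in no set.
_∋_ : Subset n → ℕ → Set
[]      ∋ i     = ⊥
(b ∷ A) ∋ zero  = b ≡ inside
(b ∷ A) ∋ suc i = A ∋ i

_∋?_ : (A : Subset n) (i : ℕ) → Dec (A ∋ i)
[]      ∋? i     = no λ ()
(b ∷ A) ∋? zero  = b Bool.≟ inside
(b ∷ A) ∋? suc i = A ∋? i

∋⇒< : (A : Subset n) {i : ℕ} → A ∋ i → i < n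
∋⇒< (b ∷ A) {zero}  _ = z<s
∋⇒< (b ∷ A) {suc i} p = s<s (∋⇒< A p)

∈⇒∋ : {A : Subset n} {x : Fin n} → x ∈ˢ A → A ∋ toℕ x
∈⇒∋ here      = refl
∈⇒∋ (there p) = ∈⇒∋ p

∋⇒∈ : (A : Subset n) {i : ℕ} → A ∋ i → ∃ λ x → toℕ x ≡ i × x ∈ˢ A
∋⇒∈ (b ∷ A) {zero}  refl = zero , refl , here
∋⇒∈ (b ∷ A) {suc i} p with x , refl , q ← ∋⇒∈ A p = suc x , refl , there q

∋-ext : (A B : Subset n) → (∀ i → A ∋ i → B ∋ i) → (∀ i → B ∋ i → A ∋ i) → A ≡ B
∋-ext []      []      f g = refl
∋-ext (a ∷ A) (b ∷ B) f g =
  cong₂ _∷_ (heads a b (f 0) (g 0)) (∋-ext A B (f ∘ suc) (g ∘ suc))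
  where
  heads : ∀ a b → (a ≡ inside → b ≡ inside) → (b ≡ inside → a ≡ inside) → a ≡ b
  heads inside  b       f g = sym (f refl)
  heads outside outside f g = refl
  heads outside inside  f g = g refl

Meets : Subset n → Subset n → Set
Meets A B = ∃ λ i → A ∋ i × B ∋ i

meets-sym : {A B : Subset n} → Meets A B → Meets B A
meets-sym (i , p , q) = i , q , p

∣A∣>0⇒∋ : (A : Subset n) → 0 < ∣ A ∣ → ∃ λ i → A ∋ i
∣A∣>0⇒∋ (inside  ∷ A) _ = 0 , refl
∣A∣>0⇒∋ (outside ∷ A) p with i , q ← ∣A∣>0⇒∋ A p = suc i , q

∣A∣>1⇒∋ : (A : Subset n) → 1 < ∣ A ∣ → ∃₂ λ i j → i < j × A ∋ i × A ∋ j
∣A∣>1⇒∋ (inside  ∷ A) (s<s p) with j , q ← ∣A∣>0⇒∋ A p = 0 , suc j , z<s , refl , q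
∣A∣>1⇒∋ (outside ∷ A) p with i , j , i<j , q , r ← ∣A∣>1⇒∋ A p =
  suc i , suc j , s<s i<j , q , r

∋⇒∣A∣>0 : (A : Subset n) {i : ℕ} → A ∋ i → 0 < ∣ A ∣
∋⇒∣A∣>0 (inside  ∷ A)         _ = z<s
∋⇒∣A∣>0 (outside ∷ A) {suc i} p = ∋⇒∣A∣>0 A p

∋⇒∣A∣>1 : (A : Subset n) {i j : ℕ} → i < j → A ∋ i → A ∋ j → 1 < ∣ A ∣
∋⇒∣A∣>1 (inside  ∷ A) {i}     {suc j} _         _ q = s<s (∋⇒∣A∣>0 A q)
∋⇒∣A∣>1 (outside ∷ A) {suc i} {suc j} (s<s i<j) p q = ∋⇒∣A∣>1 A i<j p q

singleton-≡ : (A : Subset n) {i j : ℕ} → ∣ A ∣ ≡ 1 → A ∋ i → A ∋ j → i ≡ j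
singleton-≡ A {i} {j} ∣A∣≡1 p q with <-cmp i j
... | tri< i<j _ _ = contradiction ∣A∣≡1 (>⇒≢ (∋⇒∣A∣>1 A i<j p q))
... | tri≈ _ eq _  = eq
... | tri> _ _ j<i = contradiction ∣A∣≡1 (>⇒≢ (∋⇒∣A∣>1 A j<i q p))

drop-∋⁻ : ∀ a (A : Subset (a + n)) {i} → Vec.drop a A ∋ i → A ∋ (a + i)
drop-∋⁻ zero    A       p = p
drop-∋⁻ (suc a) (_ ∷ A) p = drop-∋⁻ a A p

drop-∋⁺ : ∀ a (A : Subset (a + n)) {i} → A ∋ (a + i) → Vec.drop a A ∋ i
drop-∋⁺ zero    A       p = p
drop-∋⁺ (suc a) (_ ∷ A) p = drop-∋⁺ a A p

drop-size₀ : ∀ a (A : Subset (a + n)) → (∀ i → i < a → ¬ A ∋ i) → ∣ A ∣ ≡ ∣ Vec.drop a A ∣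
drop-size₀ zero    A             f = refl
drop-size₀ (suc a) (inside  ∷ A) f = contradiction refl (f 0 z<s)
drop-size₀ (suc a) (outside ∷ A) f = drop-size₀ a A (λ i i<a → f (suc i) (s<s i<a))

drop-size₁ : ∀ a (A : Subset (a + n)) {p} → p < a → A ∋ p →
             (∀ i → i < a → A ∋ i → i ≡ p) → ∣ A ∣ ≡ suc ∣ Vec.drop a A ∣
drop-size₁ (suc a) (inside ∷ A) {p} p<a q f =
  cong suc (drop-size₀ a A λ i i<a r →
    contradiction (trans (f (suc i) (s<s i<a) r) (sym (f 0 z<s refl))) λ ())
drop-size₁ (suc a) (outside ∷ A) {suc p} (s<s p<a) q f =
  drop-size₁ a A p<a q λ i i<a r → suc-injective (f (suc i) (s<s i<a) r)

-- Counting with duplicate-free lists.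

-- Injectivity is asked only on the entries, because merging and dropping are injective only on
-- their part of the family.
map-unique : ∀ {X Y : Set} (f : X → Y) {xs : List X} →
             (∀ {x y} → x ∈ xs → y ∈ xs → f x ≡ f y → x ≡ y) → Unique xs → Unique (map f xs)
map-unique f inj []         = []
map-unique f {x ∷ xs} inj (x∉ ∷ xs!) =
  All.tabulate distinct ∷ map-unique f (λ p q → inj (there p) (there q)) xs!
  where
  distinct : ∀ {y} → y ∈ map f xs → f x ≢ y
  distinct y∈ fx≡y with z , z∈ , refl ← ∈-map⁻ f y∈ =
    All.lookup x∉ z∈ (inj (here refl) (there z∈) fx≡y)

length-filter-¬ : ∀ {X : Set} {P : Pred X 0ℓ} (P? : Decidable P) xs →
                  length xs ≡ length (filter (¬? ∘ P?) xs) + length (filter P? xs)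
length-filter-¬ P? []       = refl
length-filter-¬ P? (x ∷ xs) with P? x
... | no  _ = cong suc (length-filter-¬ P? xs)
... | yes _ = trans (cong suc (length-filter-¬ P? xs)) (sym (+-suc _ _))

remove : ∀ {X : Set} {x : X} {ys} → x ∈ ys → ∃ λ zs →
         length ys ≡ suc (length zs) × (∀ {y} → y ∈ ys → y ≢ x → y ∈ zs)
remove (here {xs = zs} refl) = zs , refl , λ where
  (here refl) y≢x → contradiction refl y≢x
  (there y∈)  _   → y∈
remove (there {y} x∈) with zs , eq , f ← remove x∈ = y ∷ zs , cong suc eq , λ where
  (here refl) _   → here refl
  (there y∈)  y≢x → there (f y∈ y≢x)

-- Cancel the head of `xs` against one occurrence in `ys`; the later entries of `xs` differ from it,
-- so they survive in the shortened list.
unique-⊆-length : ∀ {X : Set} {xs ys : List X} → Unique xs →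
                  (∀ {x} → x ∈ xs → x ∈ ys) → length xs ≤ length ys
unique-⊆-length []         f = z≤n
unique-⊆-length (x∉ ∷ xs!) f with zs , eq , g ← remove (f (here refl)) =
  subst (_ ≤_) (sym eq) (s≤s (unique-⊆-length xs! λ y∈ →
    g (f (there y∈)) (≢-sym (All.lookup x∉ y∈))))

allSubsets-complete : (A : Subset n) → A ∈ allSubsets n
allSubsets-complete []            = here refl
allSubsets-complete (inside  ∷ A) = ∈-++⁺ˡ (∈-map⁺ (inside ∷_) (allSubsets-complete A))
allSubsets-complete (outside ∷ A) = ∈-++⁺ʳ _ (∈-map⁺ (outside ∷_) (allSubsets-complete A))

allSubsets-unique : ∀ n → Unique (allSubsets n)
allSubsets-unique zero    = [] ∷ []
allSubsets-unique (suc n) =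
  Unique.++⁺ (Unique.map⁺ (cong Vec.tail) (allSubsets-unique n))
             (Unique.map⁺ (cong Vec.tail) (allSubsets-unique n)) disjoint
  where
  disjoint : ∀ {A} → ¬ (A ∈ map (inside ∷_) (allSubsets n) × A ∈ map (outside ∷_) (allSubsets n))
  disjoint (p , q) with _ , _ , refl ← ∈-map⁻ _ p with _ , _ , () ← ∈-map⁻ _ q

-- Consecutive and pairwise separation.

-- Separation for all pairs instead of consecutive ones. Unlike Separated, it does not
-- give k < n when A is a singleton.
Sep : ℕ → Subset n → Set
Sep {n} k A = ∀ {i j} → A ∋ i → A ∋ j → i < j → (i + k < j) × (j + k < i + n)

∈-elements⁺ : (A : Subset n) {i : ℕ} → A ∋ i → i ∈ elements A
∈-elements⁺ A p with x , refl , q ← ∋⇒∈ A p = ∈-map⁺ toℕ (∈-filter⁺ (_∈ˢ? A) (∈-allFin x) q)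

∈-elements⁻ : (A : Subset n) {i : ℕ} → i ∈ elements A → A ∋ i
∈-elements⁻ {n} A p with x , q , refl ← ∈-map⁻ toℕ p =
  ∈⇒∋ (proj₂ (∈-filter⁻ (_∈ˢ? A) {xs = allFin n} q))

elements-sorted : (A : Subset n) → AllPairs _<_ (elements A)
elements-sorted A =
  AllPairs.map⁺ (AllPairs.filter⁺ (_∈ˢ? A) (AllPairs.tabulate⁺-< id))

Gap : ℕ → ℕ → ℕ → Set
Gap k a b = a + k < b

gap-trans : ∀ k {a b c} → Gap k a b → Gap k b c → Gap k a c
gap-trans k p q = <-trans p (≤-<-trans (m≤m+n _ k) q)

gap⇒< : ∀ k {a b} → Gap k a b → a < b
gap⇒< k p = ≤-<-trans (m≤m+n _ k) p

pairs⇒gap : ∀ k {xs i j} → AllPairs (Gap k) xs → i ∈ xs → j ∈ xs → i < j → Gap k i j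
pairs⇒gap k (p ∷ ps) (here refl) (here refl) i<j = contradiction i<j (<-irrefl refl)
pairs⇒gap k (p ∷ ps) (here refl) (there q)   i<j = All.lookup p q
pairs⇒gap k (p ∷ ps) (there q)   (here refl) i<j =
  contradiction i<j (<-asym (gap⇒< k (All.lookup p q)))
pairs⇒gap k (p ∷ ps) (there q)   (there r)   i<j = pairs⇒gap k ps q r i<j

pairs⇒head≤ : ∀ k {x xs i} → AllPairs (Gap k) (x ∷ xs) → i ∈ x ∷ xs → x ≤ i
pairs⇒head≤ k (p ∷ ps) (here refl) = ≤-refl
pairs⇒head≤ k (p ∷ ps) (there q)   = <⇒≤ (gap⇒< k (All.lookup p q))

pairs-last : ∀ k {y} xs {i} → AllPairs (Gap k) (xs ++ [ y ]) → i ∈ xs → Gap k i y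
pairs-last k (x ∷ xs) (p ∷ ps) (here refl) = All.lookup p (∈-++⁺ʳ xs (here refl))
pairs-last k (x ∷ xs) (p ∷ ps) (there q)   = pairs-last k xs ps q

-- `Gap k` is transitive, so it holds between any two entries of the closed list. For the
-- wrap-around, j + k < a + n for the first entry `a`, and a ≤ i.
close⇒gaps : ∀ k n {xs} → Linked (Gap k) (close n xs) →
             ∀ {i j} → i ∈ xs → j ∈ xs → i < j → (i + k < j) × (j + k < i + n)
close⇒gaps k n {a ∷ as} l p q i<j =
  pairs⇒gap k ps (∈-++⁺ˡ p) (∈-++⁺ˡ q) i<j ,
  <-≤-trans (pairs-last k (a ∷ as) ps q) (+-monoˡ-≤ n (pairs⇒head≤ k ps (∈-++⁺ˡ p)))
  where
  ps : AllPairs (Gap k) ((a ∷ as) ++ [ a + n ])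
  ps = Linked⇒AllPairs (gap-trans k) l

Separated⇒Sep : ∀ k (A : Subset n) → Separated k A → Sep k A
Separated⇒Sep {n} k A s p q i<j =
  close⇒gaps k n {elements A} s (∈-elements⁺ A p) (∈-elements⁺ A q) i<j

-- The pairwise condition never compares the first entry `a` with its own copy `a + n`; `k < n`
-- supplies that gap.
gaps⇒close : ∀ k n {xs} → k < n → AllPairs _<_ xs →
             (∀ {i j} → i ∈ xs → j ∈ xs → i < j → (i + k < j) × (j + k < i + n)) →
             Linked (Gap k) (close n xs)
gaps⇒close k n {[]}     k<n _  f = Linked.[]
gaps⇒close k n {a ∷ as} k<n ps@(p ∷ _) f =
  AllPairs⇒Linked (AllPairs.++⁺ (gaps ps λ q r i<j → proj₁ (f q r i<j)) ([] ∷ [])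
    (All.tabulate λ q → wrap q ∷ []))
  where
  gaps : ∀ {xs} → AllPairs _<_ xs → (∀ {i j} → i ∈ xs → j ∈ xs → i < j → Gap k i j) →
         AllPairs (Gap k) xs
  gaps []       g = []
  gaps (p ∷ ps) g = All.tabulate (λ q → g (here refl) (there q) (All.lookup p q))
                  ∷ gaps ps (λ q r → g (there q) (there r))
  wrap : ∀ {i} → i ∈ a ∷ as → Gap k i (a + n)
  wrap (here refl) = +-monoʳ-< a k<n
  wrap (there q)   = proj₂ (f (here refl) (there q) (All.lookup p q))

Sep⇒Separated : ∀ k (A : Subset n) → k < n → Sep k A → Separated k A
Sep⇒Separated {n} k A k<n s =
  gaps⇒close k n k<n (elements-sorted A) λ p q → s (∈-elements⁻ A p) (∈-elements⁻ A q)

-- Pascal's rule with truncated arguments.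

-- The binomial coefficient of t - 1 over r, with value 0 at t = 0, so that
-- n ∸ k * r may be truncated without breaking Pascal's rule.
shiftedC : ℕ → ℕ → ℕ
shiftedC zero    r = 0
shiftedC (suc t) r = t C r

-- For t ≤ 1 both sides vanish, since the lower index on the left is positive; from t = 2 on this is
-- the ordinary rule.
shiftedC-pascal : ∀ t r → shiftedC t (suc r) ≡ shiftedC (pred t) (suc r) + shiftedC (pred t) r
shiftedC-pascal zero          r = refl
shiftedC-pascal (suc zero)    r = k>n⇒nCk≡0 {0} {suc r} z<s
shiftedC-pascal (suc (suc t)) r = trans (sym (nCk+nC[k+1]≡[n+1]C[k+1] t r)) (+-comm (t C r) _)

shiftedC-zero : ∀ {t} → 0 < t → shiftedC t 0 ≡ 1
shiftedC-zero {suc t} _ = trans (nCk≡nC[n∸k] {0} {t} z≤n) (nCn≡1 t)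

-- Identifying the first two points.

merge : Subset (2 + n) → Subset (1 + n)
merge (a ∷ b ∷ A) = (a ∨ b) ∷ A

swap : Subset (2 + n) → Subset (2 + n)
swap (a ∷ b ∷ A) = b ∷ a ∷ A

merge-∋⁻ : (A : Subset (2 + n)) → merge A ∋ 0 → A ∋ 0 ⊎ A ∋ 1
merge-∋⁻ (inside  ∷ b ∷ A) p = inj₁ refl
merge-∋⁻ (outside ∷ b ∷ A) p = inj₂ p

-- On positions the identification is `pred`: 0 and 1 both go to 0, and the rest move down by one.
merge-∋⁺ : (A : Subset (2 + n)) → ∀ i → A ∋ i → merge A ∋ pred i
merge-∋⁺ (inside  ∷ b ∷ A) 0             _ = refl
merge-∋⁺ (inside  ∷ b ∷ A) 1             _ = refl
merge-∋⁺ (outside ∷ b ∷ A) 1             p = p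
merge-∋⁺ (_       ∷ b ∷ A) (suc (suc i)) p = p

merge-meets : (A B : Subset (2 + n)) → Meets A B → Meets (merge A) (merge B)
merge-meets A B (i , p , q) = pred i , merge-∋⁺ A i p , merge-∋⁺ B i q

merge-size : (A : Subset (2 + n)) → ¬ (A ∋ 0 × A ∋ 1) → ∣ merge A ∣ ≡ ∣ A ∣
merge-size (inside  ∷ inside  ∷ A) h = contradiction (refl , refl) h
merge-size (inside  ∷ outside ∷ A) h = refl
merge-size (outside ∷ b       ∷ A) h = refl

-- Merging forgets only which of the points 0 and 1 was present. A proper collision therefore
-- exchanges them, and it is oriented so that the swapped set contains 0, as in the definition of
-- marked sets.
merge-collision : (A B : Subset (2 + n)) → ¬ (A ∋ 0 × A ∋ 1) → ¬ (B ∋ 0 × B ∋ 1) →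
                  merge A ≡ merge B → A ≡ B ⊎ (A ∋ 0 × swap A ≡ B) ⊎ (B ∋ 0 × swap B ≡ A)
merge-collision (inside  ∷ inside  ∷ A) B hA hB eq = contradiction (refl , refl) hA
merge-collision A (inside  ∷ inside  ∷ B) hA hB eq = contradiction (refl , refl) hB
merge-collision (inside  ∷ outside ∷ A) (inside  ∷ outside ∷ B) hA hB refl = inj₁ refl
merge-collision (inside  ∷ outside ∷ A) (outside ∷ inside  ∷ B) hA hB refl = inj₂ (inj₁ (refl , refl))
merge-collision (outside ∷ inside  ∷ A) (inside  ∷ outside ∷ B) hA hB refl = inj₂ (inj₂ (refl , refl))
merge-collision (outside ∷ a       ∷ A) (outside ∷ b       ∷ B) hA hB refl = inj₁ refl

-- An intersecting family as a duplicate-free list: its cardinality is `length`, and both reductions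
-- become maps over filtered lists.
record Packed (k r : ℕ) {n : ℕ} (L : List (Subset n)) : Set where
  field
    unique : Unique L
    sep    : ∀ {A} → A ∈ L → Sep k A
    size   : ∀ {A} → A ∈ L → ∣ A ∣ ≡ r
    meets  : ∀ {A B} → A ∈ L → B ∈ L → Meets A B

-- Identification shortens by one step just the arcs that cross the pair, so only an arc of the
-- minimal 2 + k steps can become too short. Such an arc runs from 0 to 2 + k, or from `suc p + m`
-- round to `suc p`; the hypotheses exclude both.
merge-sep : ∀ k m (A : Subset (2 + k + m)) → Sep (suc k) A → ¬ (A ∋ 0 × A ∋ 2 + k) →
            (∀ p → p < suc k → A ∋ suc p → ¬ A ∋ suc p + m) → Sep (suc k) (merge A)
merge-sep k m (a ∷ b ∷ A) sep h₀ h {zero} {suc j} p q _ with merge-∋⁻ (a ∷ b ∷ A) p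
... | inj₁ p₀ =
  ≤∧≢⇒< (s≤s⁻¹ (proj₁ s)) (λ eq → h₀ (p₀ , subst (A ∋_) (sym (suc-injective eq)) q)) , s≤s⁻¹ (proj₂ s)
  where s = sep {0} {2 + j} p₀ q z<s
... | inj₂ p₁ =
  s<s⁻¹ (proj₁ s) ,
  wrap-merged-second j k m (≤∧≢⇒< (wrap-second j k m (proj₂ s))
    λ eq → h 0 z<s p₁ (subst ((b ∷ A) ∋_) eq q))
  where s = sep {1} {2 + j} p₁ q (s<s z<s)
merge-sep k m (a ∷ b ∷ A) sep h₀ h {suc i} {suc j} p q i<j =
  s<s⁻¹ (proj₁ s) , wrap-merged-later i j k m (≤∧≢⇒< (wrap-later i j k m (proj₂ s)) no-wrap)
  where
  s = sep {2 + i} {2 + j} p q (s<s i<j)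
  -- For j = i + m, the bound on `j` as a position among k + m points gives i < k, which brings
  -- `suc i` within the range of `h`.
  no-wrap : j ≢ i + m
  no-wrap refl = h (suc i) (s<s (+-cancelʳ-< m i k (∋⇒< A q))) p q

-- Marked and unmarked members of an intersecting family.

module Reduction (k′ m r : ℕ) (m>k : suc k′ < m)
                 {L : List (Subset (suc (suc k′) + m))} (packed : Packed (suc k′) (suc r) L) where
  open Packed packed

  private
    k = suc k′
    S = Subset (suc k + m)

  -- For p ≥ 1 the partner p + m is the point k + 1 steps before p on the circle.
  Continues : S → ℕ → Set
  Continues A zero    = A ∋ suc k ⊎ swap A ∈ L
  Continues A (suc p) = A ∋ (suc p + m)

  -- The window consists of the positions 0 to k and holds at most one element of a member, so `p`
  -- is determined by `A`. At p = 0, `A ∋ suc k` is the minimal gap that starts at 0, while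
  -- `swap A ∈ L` sets aside one set of each pair that `merge` would identify.
  Marked : S → Set
  Marked A = ∃ λ p → p < suc k × A ∋ p × Continues A p

  continues? : ∀ A → Decidable (Continues A)
  continues? A zero    = (A ∋? suc k) ⊎-dec (swap A ∈? L)
    where open import Data.List.Membership.DecPropositional (≡-dec {n = suc k + m} Bool._≟_) using (_∈?_)
  continues? A (suc p) = A ∋? (suc p + m)

  marked? : Decidable Marked
  marked? A = anyUpTo? (λ p → (A ∋? p) ×-dec continues? A p) (suc k)

  window-≡ : ∀ {A p q} → A ∈ L → p < suc k → q < suc k → A ∋ p → A ∋ q → p ≡ q
  window-≡ {A} {p} {q} A∈ p≤k q≤k Ap Aq with <-cmp p q
  ... | tri< p<q _ _ =
    contradiction (<-≤-trans (proj₁ (sep A∈ Ap Aq p<q)) (s≤s⁻¹ q≤k)) (≤⇒≯ (m≤n+m k p))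
  ... | tri≈ _ eq _  = eq
  ... | tri> _ _ q<p =
    contradiction (<-≤-trans (proj₁ (sep A∈ Aq Ap q<p)) (s≤s⁻¹ p≤k)) (≤⇒≯ (m≤n+m k q))

  ¬both : ∀ {A} → A ∈ L → ¬ (A ∋ 0 × A ∋ 1)
  ¬both A∈ (A0 , A1) with () ← window-≡ A∈ z<s (s<s z<s) A0 A1

  marked : List S
  marked = filter marked? L

  unmarked : List S
  unmarked = filter (¬? ∘ marked?) L

  unmarked-merge-sep : ∀ {A} → A ∈ L → ¬ Marked A → Sep k (merge A)
  unmarked-merge-sep {A} A∈ ¬marked = merge-sep k′ m A (sep A∈)
    (λ { (p , q) → ¬marked (0 , z<s , p , inj₁ q) })
    (λ p p<k q c → ¬marked (suc p , s<s p<k , q , c))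

  -- In a proper collision one of the two sets contains 0 and has its swap in `L`, so it would be
  -- marked. This gives injectivity.
  merged : Packed k (suc r) (map merge unmarked)
  merged = record
    { unique = map-unique merge injective (Unique.filter⁺ (¬? ∘ marked?) unique)
    ; sep    = λ p → sep′ p
    ; size   = size′
    ; meets  = meets′
    }
    where
    ∈⁻ : ∀ {A} → A ∈ unmarked → A ∈ L × ¬ Marked A
    ∈⁻ = ∈-filter⁻ (¬? ∘ marked?) {xs = L}
    injective : ∀ {A B} → A ∈ unmarked → B ∈ unmarked → merge A ≡ merge B → A ≡ B
    injective {A} {B} A∈ B∈ eq with ∈⁻ A∈ | ∈⁻ B∈
    ... | A∈L , ¬mA | B∈L , ¬mB with merge-collision A B (¬both A∈L) (¬both B∈L) eq
    ... | inj₁ A≡B = A≡B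
    ... | inj₂ (inj₁ (p , refl)) = contradiction (0 , z<s , p , inj₂ B∈L) ¬mA
    ... | inj₂ (inj₂ (p , refl)) = contradiction (0 , z<s , p , inj₂ A∈L) ¬mB
    sep′ : ∀ {A} → A ∈ map merge unmarked → Sep k A
    sep′ p with A , A∈ , refl ← ∈-map⁻ merge p with A∈L , ¬mA ← ∈⁻ A∈ = unmarked-merge-sep A∈L ¬mA
    size′ : ∀ {A} → A ∈ map merge unmarked → ∣ A ∣ ≡ suc r
    size′ p with A , A∈ , refl ← ∈-map⁻ merge p with A∈L , _ ← ∈⁻ A∈ =
      trans (merge-size A (¬both A∈L)) (size A∈L)
    meets′ : ∀ {A B} → A ∈ map merge unmarked → B ∈ map merge unmarked → Meets A B
    meets′ p q with A , A∈ , refl ← ∈-map⁻ merge p | B , B∈ , refl ← ∈-map⁻ merge q =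
      merge-meets A B (meets (proj₁ (∈⁻ A∈)) (proj₁ (∈⁻ B∈)))

  -- The arc across the window passes through `p`, so it consists of two arcs of at least k + 1
  -- steps each. Deleting k + 1 points leaves at least k + 1 steps.
  drop-sep : ∀ {A} → A ∈ L → Marked A → Sep k (Vec.drop (suc k) A)
  drop-sep {A} A∈ (p , p<k , Ap , c) {i} {j} q r i<j =
    +-cancelˡ-< (suc k) _ _ (subst (_< suc k + j) (+-assoc (suc k) i k) (proj₁ s)) ,
    wrap p p<k Ap c
    where
    q′ : A ∋ (suc k + i)
    q′ = drop-∋⁻ (suc k) A q
    r′ : A ∋ (suc k + j)
    r′ = drop-∋⁻ (suc k) A r
    s = sep A∈ q′ r′ (+-monoʳ-< (suc k) i<j)
    wrap : ∀ p → p < suc k → A ∋ p → Continues A p → j + k < i + m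
    wrap zero p<k Ap _ =
      wrap-dropped-first i j k′ m (proj₂ (sep A∈ Ap r′ z<s))
    wrap (suc p) p<k Ap c with suc k + j ≤? suc p + m
    ... | yes le =
      wrap-dropped i j k′ m p le (proj₁ (sep A∈ Ap q′ (<-≤-trans p<k (m≤m+n (suc k) i))))
    ... | no ¬le = contradiction (≰⇒> ¬le) (≤⇒≯ (before-partner j k′ m p
      (proj₂ (sep A∈ Ap r′ (<-≤-trans p<k (m≤m+n (suc k) j))))))

  drop-≡ : ∀ {A B} → A ∈ L → B ∈ L → ∀ {p} → p < suc k → A ∋ p → B ∋ p →
           Vec.drop (suc k) A ≡ Vec.drop (suc k) B → A ≡ B
  drop-≡ {A} {B} A∈ B∈ {p} p<k Ap Bp eq =
    ∋-ext A B (sub A B A∈ Ap Bp eq) (sub B A B∈ Bp Ap (sym eq))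
    where
    sub : ∀ (A B : S) → A ∈ L → A ∋ p → B ∋ p → Vec.drop (suc k) A ≡ Vec.drop (suc k) B →
          ∀ i → A ∋ i → B ∋ i
    sub A B A∈ Ap Bp eq i Ai with i <? suc k
    ... | yes i<k = subst (B ∋_) (window-≡ A∈ p<k i<k Ap Ai) Bp
    ... | no  i≮k with j , refl ← m≤n⇒∃[o]m+o≡n (≮⇒≥ i≮k) =
      drop-∋⁻ (suc k) B (subst (_∋ j) eq (drop-∋⁺ (suc k) A Ai))

  -- By `m>k` the partner lies beyond the window, so it is visible in the tail.
  continues-∋ : ∀ {A B : S} {q} → Vec.drop (suc k) A ≡ Vec.drop (suc k) B →
                B ∋ (suc q + m) → A ∋ (suc q + m)
  continues-∋ {A} {B} {q} eq Bq
    with j , e ← m≤n⇒∃[o]m+o≡n (≤-trans m>k (m≤n+m m (suc q))) =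
    subst (A ∋_) e (drop-∋⁻ (suc k) A (subst (_∋ j) (sym eq)
      (drop-∋⁺ (suc k) B (subst (B ∋_) (sym e) Bq))))

  -- Equal tails would put the partner of `q` into `A`. That point is k + 1 steps before `q`, hence
  -- fewer than k + 1 steps before `p`, contradicting separation.
  marked-drop-< : ∀ {A B} → A ∈ L → ∀ {p q} → p < q → q < suc k → A ∋ p → Continues B q →
                  Vec.drop (suc k) A ≢ Vec.drop (suc k) B
  marked-drop-< {A} {B} A∈ {p} {suc q} p<q q<k Ap c eq =
    contradiction p<q (≤⇒≯ (partner-order k′ m p q
      (proj₂ (sep A∈ Ap (continues-∋ {A} {B} {q} eq c) (<-≤-trans p<q (m≤m+n (suc q) m))))))

  tail-meets : ∀ {A B : S} {i} → suc k ≤ i → A ∋ i → B ∋ i →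
               Meets (Vec.drop (suc k) A) (Vec.drop (suc k) B)
  tail-meets {A} {B} k<i Ai Bi with j , refl ← m≤n⇒∃[o]m+o≡n k<i =
    j , drop-∋⁺ (suc k) A Ai , drop-∋⁺ (suc k) B Bi

  -- A common element inside the window would have to equal both `p` and `q`.
  drop-meets-≢ : ∀ {A B p q} → A ∈ L → B ∈ L → p < suc k → q < suc k → A ∋ p → B ∋ q → p ≢ q →
                 Meets (Vec.drop (suc k) A) (Vec.drop (suc k) B)
  drop-meets-≢ {A} {B} A∈ B∈ p<k q<k Ap Bq p≢q with i , Ai , Bi ← meets A∈ B∈ with i <? suc k
  ... | no  i≮k = tail-meets {A} {B} (≮⇒≥ i≮k) Ai Bi
  ... | yes i<k = contradiction
    (trans (window-≡ A∈ p<k i<k Ap Ai) (window-≡ B∈ i<k q<k Bi Bq)) p≢q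

  swap-drop : ∀ (A : S) → Vec.drop (suc k) (swap A) ≡ Vec.drop (suc k) A
  swap-drop (a ∷ b ∷ A) = refl

  swap-∋ : ∀ (A : S) → A ∋ 0 → swap A ∋ 1
  swap-∋ (a ∷ b ∷ A) p = p

  -- swap A trades the point 0 for the point 1, so it must meet B outside the window.
  drop-meets-swap : ∀ {A B} → swap A ∈ L → B ∈ L → A ∋ 0 → B ∋ 0 →
                    Meets (Vec.drop (suc k) A) (Vec.drop (suc k) B)
  drop-meets-swap {A} {B} A′∈ B∈ A0 B0 =
    subst (λ X → Meets X (Vec.drop (suc k) B)) (swap-drop A)
      (drop-meets-≢ A′∈ B∈ (s<s z<s) z<s (swap-∋ A A0) B0 λ ())

  -- Only equal window elements need the marks. For p ≥ 1 both sets contain the partner of `p`. For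
  -- p = 0 either both contain `suc k`, or one of the swaps is in `L` and meets the other set
  -- outside the window.
  drop-meets : ∀ {A B} → A ∈ L → B ∈ L → Marked A → Marked B →
               Meets (Vec.drop (suc k) A) (Vec.drop (suc k) B)
  drop-meets {A} {B} A∈ B∈ (p , p<k , Ap , c) (q , q<k , Bq , d) with p ≟ q
  ... | no p≢q = drop-meets-≢ A∈ B∈ p<k q<k Ap Bq p≢q
  drop-meets {A} {B} A∈ B∈ (suc p , _ , _ , c) (_ , _ , _ , d) | yes refl =
    tail-meets {A} {B} (≤-trans m>k (m≤n+m m (suc p))) c d
  drop-meets {A} {B} A∈ B∈ (zero , _ , Ap , inj₂ A′∈) (_ , _ , Bq , _) | yes refl =
    drop-meets-swap A′∈ B∈ Ap Bq
  drop-meets {A} {B} A∈ B∈ (zero , _ , Ap , inj₁ c) (_ , _ , Bq , inj₂ B′∈) | yes refl =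
    meets-sym {A = Vec.drop (suc k) B} {Vec.drop (suc k) A} (drop-meets-swap {B} {A} B′∈ A∈ Bq Ap)
  drop-meets {A} {B} A∈ B∈ (zero , _ , Ap , inj₁ c) (_ , _ , Bq , inj₁ d) | yes refl =
    tail-meets {A} {B} ≤-refl c d

  dropped : Packed k r (map (Vec.drop (suc k)) marked)
  dropped = record
    { unique = map-unique (Vec.drop (suc k)) injective (Unique.filter⁺ marked? unique)
    ; sep    = λ p → sep′ p
    ; size   = size′
    ; meets  = meets′
    }
    where
    D : S → Subset m
    D = Vec.drop (suc k)
    ∈⁻ : ∀ {A} → A ∈ marked → A ∈ L × Marked A
    ∈⁻ = ∈-filter⁻ marked? {xs = L}
    injective : ∀ {A B} → A ∈ marked → B ∈ marked → D A ≡ D B → A ≡ B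
    injective {A} {B} A∈ B∈ eq with ∈⁻ A∈ | ∈⁻ B∈
    ... | A∈L , p , p<k , Ap , c | B∈L , q , q<k , Bq , d with <-cmp p q
    ... | tri< p<q _ _  = contradiction eq (marked-drop-< {A} {B} A∈L p<q q<k Ap d)
    ... | tri≈ _ refl _ = drop-≡ A∈L B∈L p<k Ap Bq eq
    ... | tri> _ _ q<p  = contradiction (sym eq) (marked-drop-< {B} {A} B∈L q<p p<k Bq c)
    sep′ : ∀ {A} → A ∈ map D marked → Sep k A
    sep′ p with A , A∈ , refl ← ∈-map⁻ D p with A∈L , mA ← ∈⁻ A∈ = drop-sep A∈L mA
    size′ : ∀ {A} → A ∈ map D marked → ∣ A ∣ ≡ r
    size′ p with A , A∈ , refl ← ∈-map⁻ D p with A∈L , p , p<k , Ap , _ ← ∈⁻ A∈ =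
      suc-injective (trans (sym (drop-size₁ (suc k) A p<k Ap λ i i<k Ai →
        window-≡ A∈L i<k p<k Ai Ap)) (size A∈L))
    meets′ : ∀ {A B} → A ∈ map D marked → B ∈ map D marked → Meets A B
    meets′ p q with A , A∈ , refl ← ∈-map⁻ D p | B , B∈ , refl ← ∈-map⁻ D q
      with A∈L , mA ← ∈⁻ A∈ | B∈L , mB ← ∈⁻ B∈ = drop-meets A∈L B∈L mA mB

  length-split : length L ≡ length (map merge unmarked) + length (map (Vec.drop (suc k)) marked)
  length-split = trans (length-filter-¬ marked? L)
    (sym (cong₂ _+_ (length-map merge unmarked) (length-map (Vec.drop (suc k)) marked)))

-- The recursion and the upper bound.

-- Removing one point, or k + 1 points together with one element, lowers n − kr by one.
shiftedC-step : ∀ k′ m r → let k = suc k′ in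
  shiftedC (suc k + m ∸ k * suc (suc r)) (suc r) ≡
  shiftedC (k + m ∸ k * suc (suc r)) (suc r) + shiftedC (m ∸ k * suc r) r
shiftedC-step k′ m r = trans (shiftedC-pascal (suc k + m ∸ k * suc (suc r)) r)
  (cong₂ _+_ (cong (λ t → shiftedC t (suc r)) pred-≡)
             (cong (λ t → shiftedC t r) (trans pred-≡ drop-≡)))
  where
  k = suc k′
  pred-≡ : pred (suc k + m ∸ k * suc (suc r)) ≡ k + m ∸ k * suc (suc r)
  pred-≡ = pred[m∸n]≡m∸[1+n] (suc k + m) (k * suc (suc r))
  drop-≡ : k + m ∸ k * suc (suc r) ≡ m ∸ k * suc r
  drop-≡ = trans (cong (k + m ∸_) (*-suc k (suc r))) ([m+n]∸[m+o]≡n∸o k m (k * suc r))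

packed-singletons : ∀ {k} {L : List (Subset n)} → Packed k 1 L → length L ≤ 1
packed-singletons {L = []}        g = z≤n
packed-singletons {L = A ∷ []}    g = ≤-refl
packed-singletons {L = A ∷ B ∷ L} g with (A≢B ∷ _) ∷ _ ← Packed.unique g =
  contradiction (∋-ext A B (sub (here refl) (there (here refl)))
                           (sub (there (here refl)) (here refl))) A≢B
  where
  open Packed g
  sub : ∀ {A′ B′} → A′ ∈ A ∷ B ∷ L → B′ ∈ A ∷ B ∷ L → ∀ i → A′ ∋ i → B′ ∋ i
  sub {A′} {B′} A∈ B∈ i Ai with j , Aj , Bj ← meets A∈ B∈ =
    subst (B′ ∋_) (singleton-≡ A′ (size A∈) Aj Ai) Bj

-- The induction carries k < n, since n ≥ (k + 1)(r + 1) may fail after one point is removed. The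
-- empty list is treated apart because `m>k`, needed by the reduction, is read off from two elements
-- of an actual member.
packed-bound : ∀ k′ {n} → Acc _<_ n → ∀ r {L : List (Subset n)} → let k = suc k′ in
               k < n → Packed k (suc r) L → length L ≤ shiftedC (n ∸ k * suc r) r
packed-bound k′ {n} _ zero k<n g =
  subst (_ ≤_) (sym (shiftedC-zero (m<n⇒0<n∸m (subst (_< n) (sym (*-identityʳ (suc k′))) k<n))))
    (packed-singletons g)
packed-bound k′ _ (suc r) {[]} k<n g = z≤n
packed-bound k′ {n} (acc rec) (suc r) {L@(A ∷ _)} k<n g
  with m , refl ← m≤n⇒∃[o]m+o≡n k<n
  with i , j , i<j , Ai , Aj ← ∣A∣>1⇒∋ A (subst (1 <_) (sym (Packed.size g (here refl))) (s<s z<s)) =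
  begin
    length L
      ≡⟨ length-split ⟩
    length (map merge unmarked) + length (map (Vec.drop (suc k)) marked)
      ≤⟨ +-mono-≤ (packed-bound k′ (rec (n<1+n (k + m))) (suc r) (m<m+n k (≤-trans z<s m>k)) merged)
                  (packed-bound k′ (rec (m<n+m m z<s)) r m>k dropped) ⟩
    shiftedC (k + m ∸ k * suc (suc r)) (suc r) + shiftedC (m ∸ k * suc r) r
      ≡⟨ shiftedC-step k′ m r ⟨
    shiftedC (suc k + m ∸ k * suc (suc r)) (suc r)
      ∎
  where
  open ≤-Reasoning
  k = suc k′
  m>k : k < m
  m>k with s₁ , s₂ ← Packed.sep g (here refl) Ai Aj i<j =
    two-gaps i j k′ m s₁ s₂
  open Reduction k′ m (suc r) m>k g

-- Large stars at the first point.

-- Only a lower bound on the length is recorded; the upper bound gives equality at the end. `large`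
-- is conditional on a member because the list is empty when n ≤ k.
record StarList (k r i : ℕ) (n : ℕ) : Set where
  field
    list   : List (Subset n)
    unique : Unique list
    sep    : ∀ {A} → A ∈ list → Sep k A
    size   : ∀ {A} → A ∈ list → ∣ A ∣ ≡ suc r
    centre : ∀ {A} → A ∈ list → A ∋ i
    large  : ∀ {A} → A ∈ list → k < n
    length≥ : shiftedC (n ∸ k * suc r) r ≤ length list

∣replicate∣≡0 : ∀ n → ∣ replicate n outside ∣ ≡ 0
∣replicate∣≡0 zero    = refl
∣replicate∣≡0 (suc n) = ∣replicate∣≡0 n

block : ∀ k → Subset m → Subset (suc k + m)
block k A = inside ∷ (replicate k outside Vec.++ A)

block-∋⁻ : ∀ k (A : Subset m) {i} → block k A ∋ suc i → ∃ λ j → i ≡ k + j × A ∋ j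
block-∋⁻ zero    A p = _ , refl , p
block-∋⁻ (suc k) A {suc i} p with j , refl , q ← block-∋⁻ k A p = j , refl , q

block-∋⁺ : ∀ k (A : Subset m) {i} → A ∋ i → block k A ∋ (suc k + i)
block-∋⁺ zero    A p = p
block-∋⁺ (suc k) A p = block-∋⁺ k A p

block-size : ∀ k (A : Subset m) → ∣ block k A ∣ ≡ suc ∣ A ∣
block-size zero    A = refl
block-size (suc k) A = block-size k A

-- The new point 0 is followed by `k` empty points and then by the old point 0. The gap before the
-- new point is thus the gap that ended at the old one, or `k < m` if the old point was the only
-- element.
block-sep : ∀ k (A : Subset m) → k < m → A ∋ 0 → Sep k A → Sep k (block k A)
block-sep {m} k A k<m A0 sep {zero} {suc j} _ q _ with j , refl , q′ ← block-∋⁻ k A q =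
  s≤s (m≤m+n k j) , s<s (subst (_< k + m) (sym (+-assoc k j k)) (+-monoʳ-< k (wrap j q′)))
  where
  wrap : ∀ j → A ∋ j → j + k < m
  wrap zero    _ = k<m
  wrap (suc j) q = proj₂ (sep A0 q z<s)
block-sep {m} k A k<m A0 sep {suc i} {suc j} p q i<j
  with i , refl , p′ ← block-∋⁻ k A p | j , refl , q′ ← block-∋⁻ k A q
  with s₁ , s₂ ← sep p′ q′ (+-cancelˡ-< (suc k) i j i<j) =
  s<s (subst (_< k + j) (sym (+-assoc k i k)) (+-monoʳ-< k s₁)) ,
  s<s (subst₂ _<_ (sym (+-assoc k j k)) (sym (+-assoc k i _))
    (+-monoʳ-< k (<-≤-trans s₂ (+-monoʳ-≤ i (m≤n+m m (suc k))))))

pad : Subset (suc n) → Subset (suc (suc n))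
pad (a ∷ A) = a ∷ outside ∷ A

pad-injective : {A B : Subset (suc n)} → pad A ≡ pad B → A ≡ B
pad-injective {A = _ ∷ _} {_ ∷ _} refl = refl

pad-size : (A : Subset (suc n)) → ∣ pad A ∣ ≡ ∣ A ∣
pad-size (inside  ∷ A) = refl
pad-size (outside ∷ A) = refl

pad-centre : (A : Subset (suc n)) → A ∋ 0 → pad A ∋ 0
pad-centre (_ ∷ _) p = p

pad-∋⁻ : (A : Subset (suc n)) → ∀ {i} → pad A ∋ (2 + i) → A ∋ suc i
pad-∋⁻ (_ ∷ _) p = p

pad-sep : ∀ k (A : Subset (suc n)) → Sep k A → Sep k (pad A)
pad-sep k (a ∷ A) sep {zero} {suc (suc j)} p q _ with s₁ , s₂ ← sep {0} {suc j} p q z<s =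
  m<n⇒m<1+n s₁ , s<s s₂
pad-sep {n} k (a ∷ A) sep {suc (suc i)} {suc (suc j)} p q (s<s i<j)
  with s₁ , s₂ ← sep {suc i} {suc j} p q i<j =
  s<s s₁ , s<s (<-trans s₂ (s<s (+-monoʳ-< i (n<1+n (suc n)))))

-- This runs the recursion of the upper bound backwards: `pad` undoes merging and `block` undoes
-- dropping the window. For n ≤ k the required length is 0, so the empty list suffices.
starList₀ : ∀ k′ {n} → Acc _<_ n → ∀ r → StarList (suc k′) r 0 n
starList₀ k′ {n} _ zero with suc k′ <? n
... | no k≮n = record
  { list = [] ; unique = [] ; sep = λ () ; size = λ () ; centre = λ () ; large = λ ()
  ; length≥ = ≤-reflexive (cong (λ t → shiftedC t 0)
      (m≤n⇒m∸n≡0 (subst (n ≤_) (sym (*-identityʳ (suc k′))) (≮⇒≥ k≮n))))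
  }
... | yes k<n@(s≤s {n = n′} _) = record
  { list = A ∷ [] ; unique = [] ∷ []
  ; sep = λ { (here refl) p q i<j → contradiction (singleton-≡ A ∣A∣≡1 p q) (<⇒≢ i<j) }
  ; size = λ { (here refl) → ∣A∣≡1 }
  ; centre = λ { (here refl) → refl }
  ; large = λ _ → k<n
  ; length≥ = ≤-reflexive (shiftedC-zero (m<n⇒0<n∸m
      (subst (_< n) (sym (*-identityʳ (suc k′))) k<n)))
  }
  where
  A : Subset (suc n′)
  A = inside ∷ replicate n′ outside
  ∣A∣≡1 : ∣ A ∣ ≡ 1
  ∣A∣≡1 = cong suc (∣replicate∣≡0 n′)
starList₀ k′ {n} (acc rec) (suc r) with suc k′ <? n
... | no k≮n = record
  { list = [] ; unique = [] ; sep = λ () ; size = λ () ; centre = λ () ; large = λ ()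
  ; length≥ = ≤-reflexive (cong (λ t → shiftedC t (suc r))
      (m≤n⇒m∸n≡0 (≤-trans (≮⇒≥ k≮n) (m≤m*n (suc k′) (2 + r)))))
  }
... | yes k<n with m , refl ← m≤n⇒∃[o]m+o≡n k<n = extended
  where
  k = suc k′
  module P = StarList (starList₀ k′ (rec (n<1+n (k + m))) (suc r))
  module B = StarList (starList₀ k′ (rec (m<n+m m z<s)) r)
  padded blocks : List (Subset (suc k + m))
  padded = map pad P.list
  blocks = map (block k) B.list
  -- A block contains `suc k`, the shifted old centre. A padded set with `suc k` would come from a
  -- set containing both 0 and `k`, which are too close.
  disjoint : ∀ {A} → ¬ (A ∈ padded × A ∈ blocks)
  disjoint (p , q) with A , A∈ , refl ← ∈-map⁻ pad p | B , B∈ , eq ← ∈-map⁻ (block k) q =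
    <-irrefl refl (proj₁ (P.sep A∈ (P.centre A∈) (pad-∋⁻ A (subst (_∋ suc k)
      (sym eq) (subst (block k B ∋_) (+-identityʳ (suc k)) (block-∋⁺ k B (B.centre B∈))))) z<s))
  from-parts : ∀ {Q : Subset (suc k + m) → Set} →
               (∀ {A} → A ∈ P.list → Q (pad A)) → (∀ {A} → A ∈ B.list → Q (block k A)) →
               ∀ {A} → A ∈ padded ++ blocks → Q A
  from-parts f g A∈ with ∈-++⁻ padded A∈
  ... | inj₁ p with A , A∈ , refl ← ∈-map⁻ pad p = f A∈
  ... | inj₂ p with A , A∈ , refl ← ∈-map⁻ (block k) p = g A∈
  extended : StarList k (suc r) 0 (suc k + m)
  extended = record
    { list = padded ++ blocks
    ; unique = Unique.++⁺ (Unique.map⁺ pad-injective P.unique)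
        (Unique.map⁺ (λ eq → proj₂ (++-injective (replicate k outside) _ (cong Vec.tail eq)))
          B.unique)
        disjoint
    ; sep = from-parts {Sep k} (λ {A} A∈ → pad-sep k A (P.sep A∈))
        (λ {A} A∈ → block-sep k A (B.large A∈) (B.centre A∈) (B.sep A∈))
    ; size = from-parts (λ {A} A∈ → trans (pad-size A) (P.size A∈))
        (λ {A} A∈ → trans (block-size k A) (cong suc (B.size A∈)))
    ; centre = from-parts (λ {A} A∈ → pad-centre A (P.centre A∈)) (λ _ → refl)
    ; large = λ _ → k<n
    ; length≥ = begin
        shiftedC (suc k + m ∸ k * suc (suc r)) (suc r)
          ≡⟨ shiftedC-step k′ m r ⟩
        shiftedC (k + m ∸ k * suc (suc r)) (suc r) + shiftedC (m ∸ k * suc r) r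
          ≤⟨ +-mono-≤ P.length≥ B.length≥ ⟩
        length P.list + length B.list
          ≡⟨ cong₂ _+_ (length-map pad P.list) (length-map (block k) B.list) ⟨
        length padded + length blocks
          ≡⟨ length-++ padded ⟨
        length (padded ++ blocks)
          ∎
    }
    where open ≤-Reasoning

-- Rotation to an arbitrary centre.

rotate : Subset (suc n) → Subset (suc n)
rotate (a ∷ A) = A ∷ʳ a

∷ʳ-∋⁻ : (A : Subset n) (a : Side) → ∀ {i} → (A ∷ʳ a) ∋ i → A ∋ i ⊎ (i ≡ n × a ≡ inside)
∷ʳ-∋⁻ []      a {zero}  p = inj₂ (refl , p)
∷ʳ-∋⁻ (b ∷ A) a {zero}  p = inj₁ p
∷ʳ-∋⁻ (b ∷ A) a {suc i} p with ∷ʳ-∋⁻ A a p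
... | inj₁ q         = inj₁ q
... | inj₂ (refl , q) = inj₂ (refl , q)

∷ʳ-∋⁺ˡ : (A : Subset n) (a : Side) → ∀ {i} → A ∋ i → (A ∷ʳ a) ∋ i
∷ʳ-∋⁺ˡ (b ∷ A) a {zero}  p = p
∷ʳ-∋⁺ˡ (b ∷ A) a {suc i} p = ∷ʳ-∋⁺ˡ A a p

∷ʳ-∋⁺ʳ : (A : Subset n) {a : Side} → a ≡ inside → (A ∷ʳ a) ∋ n
∷ʳ-∋⁺ʳ []      p = p
∷ʳ-∋⁺ʳ (b ∷ A) p = ∷ʳ-∋⁺ʳ A p

rotate-injective : {A B : Subset (suc n)} → rotate A ≡ rotate B → A ≡ B
rotate-injective {A = a ∷ A} {b ∷ B} eq with refl , refl ← ∷ʳ-injective A B eq = refl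

rotate-size : (A : Subset (suc n)) → ∣ rotate A ∣ ≡ ∣ A ∣
rotate-size (a ∷ A) = ∷ʳ-size A a
  where
  ∷ʳ-size : ∀ {n} (A : Subset n) a → ∣ A ∷ʳ a ∣ ≡ ∣ a ∷ A ∣
  ∷ʳ-size []            a       = refl
  ∷ʳ-size (inside  ∷ A) inside  = cong suc (∷ʳ-size A inside)
  ∷ʳ-size (inside  ∷ A) outside = cong suc (∷ʳ-size A outside)
  ∷ʳ-size (outside ∷ A) inside  = ∷ʳ-size A inside
  ∷ʳ-size (outside ∷ A) outside = ∷ʳ-size A outside

-- For a pair involving the old first point, now last, the gap inequality and the wrap-around
-- inequality exchange roles; for other pairs both merely shift.
rotate-sep : ∀ k (A : Subset (suc n)) → Sep k A → Sep k (rotate A)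
rotate-sep {n} k (a ∷ A) sep {i} {j} p q i<j with ∷ʳ-∋⁻ A a p | ∷ʳ-∋⁻ A a q
... | inj₂ (refl , _) | inj₂ (refl , _) = contradiction i<j (<-irrefl refl)
... | inj₂ (refl , _) | inj₁ q′ = contradiction i<j (<-asym (∋⇒< A q′))
... | inj₁ p′ | inj₁ q′ with s₁ , s₂ ← sep {suc i} {suc j} p′ q′ (s<s i<j) = s<s⁻¹ s₁ , s<s⁻¹ s₂
... | inj₁ p′ | inj₂ (refl , a∈) with s₁ , s₂ ← sep {0} {suc i} a∈ p′ z<s =
  s<s⁻¹ s₂ , subst (n + k <_) (+-comm (suc n) i) (s<s (+-monoʳ-≤ n (s≤s⁻¹ s₁)))

rotateList : ∀ {k r i j} → (∀ A → A ∋ i → rotate A ∋ j) →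
             StarList k r i (suc n) → StarList k r j (suc n)
rotateList {n} {k} {j = j} f s = record
  { list = map rotate S.list
  ; unique = Unique.map⁺ rotate-injective S.unique
  ; sep = from {Sep k} (λ {A} A∈ → rotate-sep k A (S.sep A∈))
  ; size = from (λ {A} A∈ → trans (rotate-size A) (S.size A∈))
  ; centre = from {_∋ j} (λ {A} A∈ → f A (S.centre A∈))
  ; large = from {λ _ → k < suc n} S.large
  ; length≥ = subst (_ ≤_) (sym (length-map rotate S.list)) S.length≥
  }
  where
  module S = StarList s
  from : ∀ {Q : Subset (suc n) → Set} → (∀ {A} → A ∈ S.list → Q (rotate A)) →
         ∀ {A} → A ∈ map rotate S.list → Q A
  from f A∈ with A , A∈ , refl ← ∈-map⁻ rotate A∈ = f A∈

-- `d` is the distance from the centre to the last position `n`. One rotation takes the centre from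
-- 0 to `n`, and each further one lowers it by one.
starList : ∀ k′ r d {i} → d + i ≡ n → StarList (suc k′) r i (suc n)
starList {n} k′ r zero refl =
  rotateList (λ { (a ∷ A) p → ∷ʳ-∋⁺ʳ A p }) (starList₀ k′ (<-wellFounded (suc n)) r)
starList k′ r (suc d) {i} eq =
  rotateList (λ { (a ∷ A) p → ∷ʳ-∋⁺ˡ A a p }) (starList k′ r d (trans (+-suc d i) eq))

-- Passing to decidable families and the final count.

card-bound : ∀ n k′ r → let k = suc k′ in k < n → (𝒜 : Family n) (𝒜? : Decidable 𝒜) →
             𝒜 ⊆ SeparatedSets n k (suc r) → Intersecting 𝒜 → card 𝒜? ≤ shiftedC (n ∸ k * suc r) r
card-bound n k′ r k<n 𝒜 𝒜? 𝒜⊆ int = packed-bound k′ (<-wellFounded n) r k<n record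
  { unique = Unique.filter⁺ 𝒜? (allSubsets-unique n)
  ; sep    = λ {A} A∈ → Separated⇒Sep (suc k′) A (proj₂ (𝒜⊆ (∈⁻ A∈)))
  ; size   = λ A∈ → proj₁ (𝒜⊆ (∈⁻ A∈))
  ; meets  = λ {A} {B} A∈ B∈ → nonempty⇒meets A B (int (∈⁻ A∈) (∈⁻ B∈))
  }
  where
  ∈⁻ : ∀ {A} → A ∈ filter 𝒜? (allSubsets n) → 𝒜 A
  ∈⁻ A∈ = proj₂ (∈-filter⁻ 𝒜? {xs = allSubsets n} A∈)
  nonempty⇒meets : ∀ A B → Nonempty (A ∩ B) → Meets A B
  nonempty⇒meets A B (x , x∈) with x∈A , x∈B ← x∈p∩q⁻ A B x∈ = toℕ x , ∈⇒∋ x∈A , ∈⇒∋ x∈B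

card-star : ∀ n k′ r → let k = suc k′ in k < n → (x : Fin n) (𝒜 : Family n) (𝒜? : Decidable 𝒜) →
            Star k (suc r) x ⊆ 𝒜 → shiftedC (n ∸ k * suc r) r ≤ card 𝒜?
card-star (suc n) k′ r k<n x 𝒜 𝒜? star⊆ =
  ≤-trans S.length≥ (unique-⊆-length S.unique λ {A} A∈ →
    ∈-filter⁺ 𝒜? (allSubsets-complete A)
      (star⊆ ((S.size A∈ , Sep⇒Separated (suc k′) A k<n (S.sep A∈)) , x∈ A (S.centre A∈))))
  where
  module S = StarList (starList k′ r (n ∸ toℕ x) (m∸n+n≡m (s≤s⁻¹ (toℕ<n x))))
  x∈ : ∀ A → A ∋ toℕ x → x ∈ˢ A
  x∈ A p with y , eq , y∈ ← ∋⇒∈ A p = subst (_∈ˢ A) (toℕ-injective eq) y∈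

theorem2 : (n k r : ℕ) .{{_ : NonZero n}} .{{_ : NonZero k}} .{{_ : NonZero r}} →
    (k + 1) * r ≤ n →
    ((𝒜 : Family n) (𝒜? : Decidable 𝒜) →
    𝒜 ⊆ SeparatedSets n k r → Intersecting 𝒜 →
    card 𝒜? ≤ (n ∸ k * r ∸ 1) C (r ∸ 1))
    ×
    ((x : Fin n) (𝒜 : Family n) (𝒜? : Decidable 𝒜) →
    𝒜 ≐ Star k r x →
    Intersecting 𝒜 × card 𝒜? ≡ (n ∸ k * r ∸ 1) C (r ∸ 1))
theorem2 n k@(suc k′) (suc r) n≥ =
  (λ 𝒜 𝒜? 𝒜⊆ int → subst (card 𝒜? ≤_) bound-≡ (card-bound n k′ r k<n 𝒜 𝒜? 𝒜⊆ int)) ,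
  λ x 𝒜 𝒜? (𝒜⊆ , ⊆𝒜) →
    let int : Intersecting 𝒜
        int = λ A∈ B∈ → x , x∈p∩q⁺ (proj₂ (𝒜⊆ A∈) , proj₂ (𝒜⊆ B∈))
    in int , trans (≤-antisym (card-bound n k′ r k<n 𝒜 𝒜? (λ A∈ → proj₁ (𝒜⊆ A∈)) int)
                              (card-star n k′ r k<n x 𝒜 𝒜? ⊆𝒜)) bound-≡
  where
  -- With at least one element, (k + 1)(r + 1) exceeds k(r + 1), so n ∸ k(r + 1) is positive and
  -- `shiftedC` is the binomial coefficient of the theorem.
  kr<n : k * suc r < n
  kr<n = <-≤-trans (*-monoˡ-< (suc r) (m<m+n k z<s)) n≥
  k<n : k < n
  k<n = ≤-<-trans (m≤m*n k (suc r)) kr<n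
  shiftedC-pos : ∀ {t} → 0 < t → shiftedC t r ≡ (t ∸ 1) C r
  shiftedC-pos {suc t} _ = refl
  bound-≡ : shiftedC (n ∸ k * suc r) r ≡ (n ∸ k * suc r ∸ 1) C r
  bound-≡ = shiftedC-pos (m<n⇒0<n∸m kr<n)
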